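{- For all integers $\Delta \geq 3$, $r \geq 1$ and $g \geq 1$ there exists a connected graph $H$ with maximum degree $\Delta$, power domination number $\gamma_p(H) = g$, propagation radius $rad_p(H) = r$ and order $n = g(r\Delta + 1)$.
   Context: All graphs are finite, simple, undirected and non-empty. For a graph $G$ and $S \subseteq V(G)$, define $P^1_G(S) = N[S]$ (the closed neighbourhood of $S$), and for $i \geq 1$ let $V^i = \{v \in P^i_G(S) : |N[v] \setminus P^i_G(S)| \leq 1\}$ and $P^{i+1}_G(S) = P^i_G(S) \cup N[V^i]$. The set $S$ is a power dominating set (PDS) of $G$ if $P^i_G(S) = V(G)$ for some $i \ge 1$. The power domination number $\gamma_p(G)$ is the minimum cardinality of a PDS of $G$. For a PDS $S$, $rad_p(G,S) = \min\{i \geq 1 : P^i_G(S) = V(G)\}$. The propagation radius of $G$ is $rad_p(G) = \min\{rad_p(G,S) : S \text{ is a PDS of } G \text{ with } |S| = \gamma_p(G)\}$. -}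

module Defs where

open import Data.Nat.Base using (ℕ; zero; suc; _≤_; NonZero)
open import Data.Nat.Properties using (_≤?_)
open import Data.Fin.Base using (Fin)
open import Data.Fin.Properties using (any?)
open import Data.Fin.Subset using (Subset; ⊤; _∈_; _∪_; _─_; ⁅_⁆; ∣_∣)
open import Data.Fin.Subset.Properties using (_∈?_)
open import Data.Product.Base using (_×_; ∃-syntax)
open import Data.Vec.Base using (tabulate)
open import Level using (0ℓ)
open import Relation.Binary.Core using (Rel)
open import Relation.Binary.Construct.Closure.ReflexiveTransitive using (Star)
open import Relation.Binary.Definitions using (Decidable; Irreflexive; Symmetric)
open import Relation.Binary.PropositionalEquality.Core using (_≡_)
open import Relation.Nullary.Decidable using (does; _×-dec_)
open import Relation.Unary using (Pred)
import Relation.Unary as Unary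

IsMin : Pred ℕ 0ℓ → Pred ℕ 0ℓ
IsMin Q m = Q m × (∀ k → Q k → m ≤ k)

IsMax : Pred ℕ 0ℓ → Pred ℕ 0ℓ
IsMax Q m = Q m × (∀ k → Q k → k ≤ m)

subset : ∀ {n} {Q : Pred (Fin n) 0ℓ} → Unary.Decidable Q → Subset n
subset Q? = tabulate (λ v → does (Q? v))

-- Finite, simple, undirected, non-empty graphs.  Adjacency is required to be
-- decidable so that neighbourhoods are finite subsets with a cardinality;
-- classically this is no restriction.
record Graph : Set₁ where
  infix 4 _~_ _~?_
  field
    order    : ℕ
    nonEmpty : NonZero order
    _~_      : Rel (Fin order) 0ℓ
    _~?_     : Decidable _~_
    ~-sym    : Symmetric _~_
    ~-irrefl : Irreflexive _≡_ _~_

  Vertex : Set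
  Vertex = Fin order

  VertexSet : Set
  VertexSet = Subset order

  N⟨_⟩ : Vertex → VertexSet
  N⟨ v ⟩ = subset (v ~?_)

  N[_] : Vertex → VertexSet
  N[ v ] = ⁅ v ⁆ ∪ N⟨ v ⟩

  -- The closed neighbourhood of a set: the union of all N[ v ] with v ∈ S.
  N[_]ₛ : VertexSet → VertexSet
  N[ S ]ₛ = subset (λ u → any? (λ v → (v ∈? S) ×-dec (u ∈? N[ v ])))

  degree : Vertex → ℕ
  degree v = ∣ N⟨ v ⟩ ∣

  IsMaximumDegree : Pred ℕ 0ℓ
  IsMaximumDegree = IsMax (λ d → ∃[ v ] degree v ≡ d)

  -- Any two vertices are joined by a walk.
  Connected : Set
  Connected = ∀ u v → Star _~_ u v

  -- For a monitored set X, the vertices of X with at most one neighbour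
  -- outside X: this gives Vⁱ when X = Pⁱ(S).
  propagating : VertexSet → VertexSet
  propagating X = subset (λ v → (v ∈? X) ×-dec (∣ N[ v ] ─ X ∣ ≤? 1))

  -- P S i is Pⁱ(S), which is meaningful for i ≥ 1 only.  The value at 0 is
  -- arbitrary: every use below demands 1 ≤ i.
  P : VertexSet → ℕ → VertexSet
  P S zero          = S
  P S (suc zero)    = N[ S ]ₛ
  P S (suc (suc i)) = P S (suc i) ∪ N[ propagating (P S (suc i)) ]ₛ

  IsPDS : Pred VertexSet 0ℓ
  IsPDS S = ∃[ i ] (1 ≤ i × P S i ≡ ⊤)

  -- Numerical invariants given by minima are rendered as predicates holding
  -- of (at most) one number; IsPowerDominationNumber g reads γₚ = g, etc.
  IsPowerDominationNumber : Pred ℕ 0ℓ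
  IsPowerDominationNumber = IsMin (λ k → ∃[ S ] (IsPDS S × ∣ S ∣ ≡ k))

  IsRadiusOf : VertexSet → Pred ℕ 0ℓ
  IsRadiusOf S = IsMin (λ i → 1 ≤ i × P S i ≡ ⊤)

  IsPropagationRadius : Pred ℕ 0ℓ
  IsPropagationRadius = IsMin (λ r →
    ∃[ S ] (IsPDS S × IsPowerDominationNumber ∣ S ∣ × IsRadiusOf S r))

{-# OPTIONS --safe #-}

-- H consists of g spiders, each a centre with Δ legs that are paths on r
-- vertices; the ends of the zeroth legs are joined in a path.  The centres
-- monitor everything in exactly r steps.  A spider without a chosen vertex can
-- be entered only through its zeroth leg, and then its centre always has the two
-- unmonitored neighbours on legs 1 and 2, so every power dominating set meets
-- every spider.  A minimum one meets each spider once, hence misses leg 1 or 2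
-- of a given spider, whose end is reached from the centre at one vertex per step.
module Submission where

open import Defs
open import Data.Nat.Base using (ℕ; _+_; _*_; _≥_; zero; suc; _≤_; _<_; z≤n; s≤s; s≤s⁻¹)
open import Data.Product.Base using (Σ; _×_; _,_; proj₁; proj₂; ∃-syntax)
open import Relation.Binary.PropositionalEquality.Core
  using (_≡_; refl; sym; trans; cong; subst; subst₂; _≢_)

open import Data.Empty using (⊥)
open import Data.Fin.Base as Fin using (Fin; zero; suc; toℕ; fromℕ; inject₁; pred)
open import Data.Fin.Patterns using (0F; 1F; 2F)
open import Data.Fin.Properties as Fin
  using (any?; toℕ-injective; toℕ-fromℕ; toℕ-inject₁; toℕ<n; toℕ≤pred[n]; suc-injective; *↔×; +↔⊎; 1↔⊤)
open import Data.Fin.Subset using (Subset; ⊤; _∈_; _∉_; _─_; _-_; _⊆_; ⁅_⁆; ∣_∣; inside; outside)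
open import Data.Fin.Subset.Properties
open import Data.Nat.Properties as ℕ
  using (_≤?_; _≟_; ≤-refl; ≤-reflexive; ≤-trans; ≤-antisym; n≤1+n; m≤n⇒m≤1+n; m≤n⇒m<n∨m≡n; 1+n≰n; ≰⇒>)
open import Data.Product.Function.NonDependent.Propositional using (_×-↔_)
open import Data.Sum.Base using (_⊎_; inj₁; inj₂; swap)
open import Data.Sum.Function.Propositional using (_⊎-↔_)
open import Data.Unit.Base using (tt) renaming (⊤ to Unit)
open import Data.Vec.Base using (_∷_; there)
open import Data.Vec.Properties using ([]=⇒lookup; lookup⇒[]=; lookup∘tabulate)
open import Function.Base using (_∘_; const)
open import Function.Bundles using (Inverse; _↔_)
open import Function.Construct.Composition using (_↔-∘_)
open import Function.Construct.Identity using (↔-id)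
open import Level using (0ℓ)
open import Relation.Binary.Construct.Closure.ReflexiveTransitive using (Star; ε; _◅_; _◅◅_; gmap; reverse)
open import Relation.Binary.Definitions using (Decidable)
open import Relation.Nullary.Decidable using (Dec; yes; no; does; dec-true; map′; _×-dec_; _⊎-dec_)
open import Relation.Nullary.Negation using (¬_; contradiction)
open import Relation.Unary using (Pred)
import Relation.Unary as Unary

-- Membership and cardinality of finite subsets.

module _ {n} {Q : Pred (Fin n) 0ℓ} (Q? : Unary.Decidable Q) where

  ∈-subset⁺ : ∀ {v} → Q v → v ∈ subset Q?
  ∈-subset⁺ {v} q = lookup⇒[]= v _ (trans (lookup∘tabulate _ v) (dec-true (Q? v) q))

  ∈-subset⁻ : ∀ {v} → v ∈ subset Q? → Q v
  ∈-subset⁻ {v} v∈ with Q? v | trans (sym (lookup∘tabulate (does ∘ Q?) v)) ([]=⇒lookup v∈)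
  ... | yes q | _ = q

x∈p─q⇒x∉q : ∀ {n x} (p q : Subset n) → x ∈ p ─ q → x ∉ q
x∈p─q⇒x∉q (_ ∷ p) (inside ∷ q)  (there x∈) (there x∈q) = x∈p─q⇒x∉q p q x∈ x∈q
x∈p─q⇒x∉q (_ ∷ p) (outside ∷ q) (there x∈) (there x∈q) = x∈p─q⇒x∉q p q x∈ x∈q

∣p∣≤1+∣p-x∣ : ∀ {n} (p : Subset n) x → ∣ p ∣ ≤ suc ∣ p - x ∣
∣p∣≤1+∣p-x∣ (inside ∷ p)  zero    = ≤-reflexive (cong (suc ∘ ∣_∣) (sym (p─⊥≡p p)))
∣p∣≤1+∣p-x∣ (outside ∷ p) zero    = m≤n⇒m≤1+n (≤-reflexive (cong ∣_∣ (sym (p─⊥≡p p))))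
∣p∣≤1+∣p-x∣ (inside ∷ p)  (suc x) = s≤s (∣p∣≤1+∣p-x∣ p x)
∣p∣≤1+∣p-x∣ (outside ∷ p) (suc x) = ∣p∣≤1+∣p-x∣ p x

injective⇒≤∣p∣ : ∀ {m n} (p : Subset n) (f : Fin m → Fin n) →
  (∀ {i j} → f i ≡ f j → i ≡ j) → (∀ i → f i ∈ p) → m ≤ ∣ p ∣
injective⇒≤∣p∣ {zero}  p f inj f∈p = z≤n
injective⇒≤∣p∣ {suc m} p f inj f∈p = ≤-trans (s≤s ih) (x∈p⇒∣p-x∣<∣p∣ (f∈p zero))
  where
  ih : m ≤ ∣ p - f zero ∣
  ih = injective⇒≤∣p∣ (p - f zero) (f ∘ suc) (suc-injective ∘ inj)
         (λ i → x∈p∧x≢y⇒x∈p-y (f∈p (suc i)) (λ eq → contradiction (inj eq) λ ()))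

-- The family `f` may repeat values and may leave `p`, so an upper bound needs only a crude list of
-- candidates.
covered⇒∣p∣≤ : ∀ {m n} (p : Subset n) (f : Fin m → Fin n) →
  (∀ {x} → x ∈ p → ∃[ i ] f i ≡ x) → ∣ p ∣ ≤ m
covered⇒∣p∣≤ {zero} {n} p f cov = ≤-reflexive (trans (cong ∣_∣ (Empty-unique p-empty)) (∣⊥∣≡0 n))
  where
  p-empty : ¬ (∃[ x ] x ∈ p)
  p-empty (x , x∈p) with cov x∈p
  ... | () , _
covered⇒∣p∣≤ {suc m} p f cov = ≤-trans (∣p∣≤1+∣p-x∣ p (f zero)) (s≤s (covered⇒∣p∣≤ (p - f zero) (f ∘ suc) cov′))
  where
  cov′ : ∀ {x} → x ∈ p - f zero → ∃[ i ] f (suc i) ≡ x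
  cov′ {x} x∈ with cov (p─q⊆p p ⁅ f zero ⁆ x∈)
  ... | zero  , refl = contradiction (x∈⁅x⁆ x) (x∈p─q⇒x∉q p ⁅ x ⁆ x∈)
  ... | suc i , eq   = i , eq

-- Neighbourhoods and propagation in an arbitrary graph.

module _ (G : Graph) where
  open Graph G

  ∈N[]⁺ : ∀ u v → u ≡ v ⊎ v ~ u → u ∈ N[ v ]
  ∈N[]⁺ _ v (inj₁ refl) = x∈p∪q⁺ (inj₁ (x∈⁅x⁆ v))
  ∈N[]⁺ _ v (inj₂ v~u)  = x∈p∪q⁺ {p = ⁅ v ⁆} (inj₂ (∈-subset⁺ (v ~?_) v~u))

  ∈N[]⁻ : ∀ {u v} → u ∈ N[ v ] → u ≡ v ⊎ v ~ u
  ∈N[]⁻ {v = v} u∈ with x∈p∪q⁻ ⁅ v ⁆ N⟨ v ⟩ u∈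
  ... | inj₁ u∈⁅v⁆ = inj₁ (x∈⁅y⁆⇒x≡y v u∈⁅v⁆)
  ... | inj₂ u∈N   = inj₂ (∈-subset⁻ (v ~?_) u∈N)

  ∈N[]ₛ⁺ : ∀ {S u v} → v ∈ S → u ∈ N[ v ] → u ∈ N[ S ]ₛ
  ∈N[]ₛ⁺ {S} v∈S u∈ = ∈-subset⁺ (λ u → any? (λ v → (v ∈? S) ×-dec (u ∈? N[ v ]))) (_ , v∈S , u∈)

  ∈N[]ₛ⁻ : ∀ {S u} → u ∈ N[ S ]ₛ → ∃[ v ] (v ∈ S × u ∈ N[ v ])
  ∈N[]ₛ⁻ {S} = ∈-subset⁻ (λ u → any? (λ v → (v ∈? S) ×-dec (u ∈? N[ v ])))

  ∈propagating⁺ : ∀ {X v} → v ∈ X → ∣ N[ v ] ─ X ∣ ≤ 1 → v ∈ propagating X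
  ∈propagating⁺ {X} v∈X small = ∈-subset⁺ (λ v → (v ∈? X) ×-dec (∣ N[ v ] ─ X ∣ ≤? 1)) (v∈X , small)

  ∈propagating⁻ : ∀ {X v} → v ∈ propagating X → v ∈ X × ∣ N[ v ] ─ X ∣ ≤ 1
  ∈propagating⁻ {X} = ∈-subset⁻ (λ v → (v ∈? X) ×-dec (∣ N[ v ] ─ X ∣ ≤? 1))

  -- The induction principle behind both lower bounds. The index is shifted: `Q i` describes the set
  -- after round `suc i`, since the first meaningful round is 1.
  P-invariant : ∀ S (Q : ℕ → Pred Vertex 0ℓ) →
    (∀ {u v} → v ∈ S → u ∈ N[ v ] → Q 0 u) →
    (∀ {i u} → Q i u → Q (suc i) u) →
    (∀ {i X u v} → (∀ {x} → x ∈ X → Q i x) → v ∈ X → ∣ N[ v ] ─ X ∣ ≤ 1 → u ∈ N[ v ] → Q (suc i) u) →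
    ∀ i {u} → u ∈ P S (suc i) → Q i u
  P-invariant S Q base mono step zero u∈ with ∈N[]ₛ⁻ u∈
  ... | v , v∈S , u∈N[v] = base v∈S u∈N[v]
  P-invariant S Q base mono step (suc i) u∈ with x∈p∪q⁻ (P S (suc i)) _ u∈
  ... | inj₁ u∈P = mono (P-invariant S Q base mono step i u∈P)
  ... | inj₂ u∈N with ∈N[]ₛ⁻ u∈N
  ...   | v , v∈V , u∈N[v] with ∈propagating⁻ v∈V
  ...     | v∈P , small = step (P-invariant S Q base mono step i) v∈P small u∈N[v]

  P⊆P-suc : ∀ S i → P S (suc i) ⊆ P S (suc (suc i))
  P⊆P-suc S i u∈P = x∈p∪q⁺ {p = P S (suc i)} {q = N[ propagating (P S (suc i)) ]ₛ} (inj₁ u∈P)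

  N⊆P-suc : ∀ S i v → v ∈ P S (suc i) → ∣ N[ v ] ─ P S (suc i) ∣ ≤ 1 → N[ v ] ⊆ P S (suc (suc i))
  N⊆P-suc S i v v∈P small u∈N[v] =
    x∈p∪q⁺ {p = P S (suc i)} {q = N[ propagating (P S (suc i)) ]ₛ}
      (inj₂ (∈N[]ₛ⁺ {v = v} (∈propagating⁺ v∈P small) u∈N[v]))

-- Saturating successor and predecessor on `Fin`.

next : ∀ {n} → Fin n → Fin n
next {suc zero}    zero    = zero
next {suc (suc n)} zero    = suc zero
next {suc (suc n)} (suc i) = suc (next i)

next-unique : ∀ {n} {i j : Fin n} → toℕ j ≡ suc (toℕ i) → next i ≡ j
next-unique {suc (suc n)} {zero}  {suc zero} eq = refl
next-unique {suc (suc n)} {suc i} {suc j}    eq = cong suc (next-unique (ℕ.suc-injective eq))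

pred-unique : ∀ {n} {i j : Fin n} → toℕ i ≡ suc (toℕ j) → pred i ≡ j
pred-unique {i = suc i} eq = toℕ-injective (trans (toℕ-inject₁ i) (ℕ.suc-injective eq))

-- The graph of linked spiders.

module Spiders (ρ δ γ : ℕ) where

  -- The shifts build in the three hypotheses: every leg has a vertex, legs 0, 1 and 2 exist, and
  -- there is a spider 0. The last vertex of a leg has index `ρ`.
  r Δ g : ℕ
  r = suc ρ
  Δ = 3 + δ
  g = suc γ

  V : Set
  V = Fin g × ((Fin r × Fin Δ) ⊎ Unit)

  pattern centre i  = i , inj₂ tt
  pattern leg i d k = i , inj₁ (d , k)

  abstract
    -- The prescribed order has the shape of the vertex type, so it needs no computation. The
    -- bijection stays opaque and is used only through its two inverse laws.
    encoding : Fin (g * (r * Δ + 1)) ↔ V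
    encoding = (↔-id _ ×-↔ ((*↔× ⊎-↔ 1↔⊤) ↔-∘ +↔⊎)) ↔-∘ *↔×

  open Inverse encoding using (to; from; strictlyInverseˡ; strictlyInverseʳ)

  -- Each edge is listed in one direction, outwards along legs and towards the larger spider index
  -- for links; `Adj` symmetrises. For `r` equal to 1 a leg has one vertex, which is both its first
  -- and its last.
  data Arc : V → V → Set where
    spoke : ∀ {i k} → Arc (centre i) (leg i zero k)
    along : ∀ {i d d′ k} → toℕ d′ ≡ suc (toℕ d) → Arc (leg i d k) (leg i d′ k)
    link  : ∀ {i j d d′} → toℕ d ≡ ρ → toℕ d′ ≡ ρ → toℕ j ≡ suc (toℕ i) → Arc (leg i d zero) (leg j d′ zero)

  arc? : Decidable Arc
  arc? (centre i) (centre j) = no λ ()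
  arc? (centre i) (leg j zero k) = map′ (λ { refl → spoke }) (λ { spoke → refl }) (i Fin.≟ j)
  arc? (centre i) (leg j (suc d) k) = no λ ()
  arc? (leg i d k) (centre j) = no λ ()
  arc? (leg i d k) (leg j d′ k′) = map′
    (λ { (inj₁ (refl , refl , eq)) → along eq ; (inj₂ (refl , refl , p , q , s)) → link p q s })
    (λ { (along eq) → inj₁ (refl , refl , eq) ; (link p q s) → inj₂ (refl , refl , p , q , s) })
    ((i Fin.≟ j ×-dec k Fin.≟ k′ ×-dec toℕ d′ ≟ suc (toℕ d)) ⊎-dec
     (k Fin.≟ zero ×-dec k′ Fin.≟ zero ×-dec toℕ d ≟ ρ ×-dec toℕ d′ ≟ ρ ×-dec toℕ j ≟ suc (toℕ i)))

  arc-irrefl : ∀ {v} → ¬ Arc v v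
  arc-irrefl (along eq)    = 1+n≰n (≤-reflexive (sym eq))
  arc-irrefl (link _ _ eq) = 1+n≰n (≤-reflexive (sym eq))

  Adj : V → V → Set
  Adj v w = Arc v w ⊎ Arc w v

  H : Graph
  H = record
    { order    = g * (r * Δ + 1)
    ; nonEmpty = _
    ; _~_      = λ u v → Adj (to u) (to v)
    ; _~?_     = λ u v → arc? (to u) (to v) ⊎-dec arc? (to v) (to u)
    ; ~-sym    = swap
    ; ~-irrefl = λ { refl (inj₁ a) → arc-irrefl a ; refl (inj₂ a) → arc-irrefl a }
    }

  open Graph H

  from-injective : ∀ {v w} → from v ≡ from w → v ≡ w
  from-injective {v} {w} eq = trans (sym (strictlyInverseˡ v)) (trans (cong to eq) (strictlyInverseˡ w))

  adj⇒~ : ∀ {v w} → Adj v w → from v ~ from w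
  adj⇒~ {v} {w} = subst₂ Adj (sym (strictlyInverseˡ v)) (sym (strictlyInverseˡ w))

  -- Connectedness

  -- Recursion runs on `n`, because `inject₁ d` is not a subterm of `suc d`.
  leg⇝centre : ∀ n {i d k} → toℕ d ≡ n → Star Adj (leg i d k) (centre i)
  leg⇝centre zero    {d = zero}  eq = inj₂ spoke ◅ ε
  leg⇝centre (suc n) {d = suc d} eq =
    inj₂ (along {d = inject₁ d} (cong suc (sym (toℕ-inject₁ d)))) ◅
    leg⇝centre n (trans (toℕ-inject₁ d) (ℕ.suc-injective eq))

  tip : Fin r
  tip = fromℕ ρ

  -- Walk out to the end of leg 0, cross the link to the previous spider, walk in to its centre, and
  -- repeat.
  centre⇝first : ∀ n {i} → toℕ i ≡ n → Star Adj (centre i) (centre zero)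
  centre⇝first zero    {zero}  eq = ε
  centre⇝first (suc n) {suc i} eq =
    reverse swap (leg⇝centre _ refl) ◅◅
    inj₂ (link (toℕ-fromℕ ρ) (toℕ-fromℕ ρ) (cong suc (sym (toℕ-inject₁ i)))) ◅
    leg⇝centre _ {inject₁ i} {tip} refl ◅◅
    centre⇝first n (trans (toℕ-inject₁ i) (ℕ.suc-injective eq))

  ⇝first : ∀ v → Star Adj v (centre zero)
  ⇝first (centre i)  = centre⇝first _ refl
  ⇝first (leg i d k) = leg⇝centre _ refl ◅◅ centre⇝first _ refl

  connected : Connected
  connected u v = subst₂ (Star _~_) (strictlyInverseʳ u) (strictlyInverseʳ v)
    (gmap from adj⇒~ (⇝first (to u) ◅◅ reverse swap (⇝first (to v))))

  -- Degrees

  parent : V → V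
  parent (centre i)        = centre i
  parent (leg i zero k)    = centre i
  parent (leg i (suc d) k) = leg i (inject₁ d) k

  parent-unique : ∀ {i d d′ k} → toℕ d′ ≡ suc (toℕ d) → parent (leg i d′ k) ≡ leg i d k
  parent-unique {i} {d′ = suc d′} {k} eq = cong (λ d → leg i d k) (pred-unique eq)

  -- Only a covering of the neighbourhood: next and pred saturate, so the list may
  -- repeat entries and contain non-neighbours.
  neighbour : V → Fin Δ → V
  neighbour (centre i) k = leg i zero k
  neighbour v@(leg i d k) zero = parent v
  neighbour (leg i d k) (suc s) with toℕ d ≟ ρ | s
  ... | no _  | _     = leg i (next d) k
  ... | yes _ | zero  = leg (pred i) d k
  ... | yes _ | suc _ = leg (next i) d k

  along⇒≢ρ : ∀ {d d′ : Fin r} → toℕ d′ ≡ suc (toℕ d) → toℕ d ≢ ρ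
  along⇒≢ρ {d′ = d′} eq p = 1+n≰n (subst (_≤ ρ) (trans eq (cong suc p)) (toℕ≤pred[n] d′))

  -- On a leg, slot 0 holds the parent. Slot 1 holds the child of an inner vertex; at a linked end,
  -- slots 1 and 2 hold the ends in the previous and the next spider. Three slots thus suffice away
  -- from the centres.
  adj⇒neighbour : ∀ {v w} → Adj v w → ∃[ s ] neighbour v s ≡ w
  adj⇒neighbour (inj₁ (spoke {k = k})) = k , refl
  adj⇒neighbour (inj₂ spoke) = zero , refl
  adj⇒neighbour {leg i d k} {leg .i d′ .k} (inj₁ (along eq)) = 1F , lemma
    where
    lemma : neighbour (leg i d k) 1F ≡ leg i d′ k
    lemma with toℕ d ≟ ρ
    ... | yes p = contradiction p (along⇒≢ρ {d} eq)
    ... | no _  = cong (λ e → leg i e k) (next-unique eq)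
  adj⇒neighbour (inj₂ (along eq)) = zero , parent-unique eq
  adj⇒neighbour {leg i d k} {leg j d′ k} (inj₁ (link p q s)) = 2F , lemma
    where
    lemma : neighbour (leg i d zero) 2F ≡ leg j d′ zero
    lemma with toℕ d ≟ ρ
    ... | no ¬p = contradiction p ¬p
    ... | yes _ with toℕ-injective {i = d} {d′} (trans p (sym q)) | next-unique {i = i} {j} s
    ...   | refl | refl = refl
  adj⇒neighbour {leg i d k} {leg j d′ k} (inj₂ (link p q s)) = 1F , lemma
    where
    lemma : neighbour (leg i d zero) 1F ≡ leg j d′ zero
    lemma with toℕ d ≟ ρ
    ... | no ¬p = contradiction q ¬p
    ... | yes _ with toℕ-injective {i = d} {d′} (trans q (sym p)) | pred-unique {i = i} {j} s
    ...   | refl | refl = refl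

  degree≤Δ : ∀ v → degree v ≤ Δ
  degree≤Δ v = covered⇒∣p∣≤ N⟨ v ⟩ (from ∘ neighbour (to v)) λ {x} x∈ →
    let s , eq = adj⇒neighbour (∈-subset⁻ (v ~?_) x∈)
    in s , trans (cong from eq) (strictlyInverseʳ x)

  Δ≤degree : Δ ≤ degree (from (centre zero))
  Δ≤degree = injective⇒≤∣p∣ N⟨ from (centre zero) ⟩ (λ k → from (leg zero zero k))
    (λ eq → leg-injective (from-injective eq))
    (λ k → ∈-subset⁺ (from (centre zero) ~?_) (adj⇒~ (inj₁ spoke)))
    where
    leg-injective : ∀ {i j : Fin g} {d e : Fin r} {k l : Fin Δ} →
      _≡_ {A = V} (leg i d k) (leg j e l) → k ≡ l
    leg-injective refl = refl

  maximumDegree : IsMaximumDegree Δ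
  maximumDegree =
    (from (centre zero) , ≤-antisym (degree≤Δ _) Δ≤degree) ,
    λ { _ (v , refl) → degree≤Δ v }

  -- The set of all centres

  depth : V → ℕ
  depth (centre i)  = 0
  depth (leg i d k) = suc (toℕ d)

  depth≤r : ∀ v → depth v ≤ r
  depth≤r (centre i)  = z≤n
  depth≤r (leg i d k) = toℕ<n d

  centre? : Unary.Decidable (λ u → depth (to u) ≡ 0)
  centre? u = depth (to u) ≟ 0

  centres : VertexSet
  centres = subset centre?

  from-centre∈centres : ∀ j → from (centre j) ∈ centres
  from-centre∈centres j = ∈-subset⁺ centre? (cong depth (strictlyInverseˡ (centre j)))

  -- The bound `toℕ d < ρ` rules out links, and the depth condition rules out the parent.
  child-unique : ∀ {i d k w} → Adj (leg i d k) w → toℕ d < ρ → suc (toℕ d) < depth w → leg i (next d) k ≡ w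
  child-unique {i} {k = k} (inj₁ (along eq)) d<ρ deep = cong (λ e → leg i e k) (next-unique eq)
  child-unique (inj₁ (link p q s)) d<ρ deep = contradiction (subst (_< ρ) p d<ρ) 1+n≰n
  child-unique {d = d} (inj₂ (along eq)) d<ρ deep =
    contradiction (≤-trans deep (≤-trans (≤-reflexive (sym eq)) (n≤1+n _))) 1+n≰n
  child-unique (inj₂ (link p q s)) d<ρ deep = contradiction (subst (_< ρ) q d<ρ) 1+n≰n

  unmonitored-child : ∀ {i j d k X} → (∀ v → depth v ≤ suc i → from v ∈ X) →
    toℕ d ≡ i → toℕ d < ρ → ∣ N[ from (leg j d k) ] ─ X ∣ ≤ 1
  unmonitored-child {j = j} {d} {k} {X} shallow∈X refl d<ρ =
    covered⇒∣p∣≤ (N[ v ] ─ X) (const {B = Fin 1} (from (leg j (next d) k))) λ x∈ → zero , only x∈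
    where
    v : Vertex
    v = from (leg j d k)

    only : ∀ {x} → x ∈ N[ v ] ─ X → from (leg j (next d) k) ≡ x
    only {x} x∈ with ∈N[]⁻ H (p─q⊆p N[ v ] X x∈) | depth (to x) ≤? suc (toℕ d)
    ... | _ | yes shallow = contradiction
            (subst (_∈ X) (strictlyInverseʳ x) (shallow∈X (to x) shallow))
            (x∈p─q⇒x∉q N[ v ] X x∈)
    ... | inj₁ refl | no deep = contradiction (≤-reflexive (cong depth (strictlyInverseˡ (leg j d k)))) deep
    ... | inj₂ v~x  | no deep = trans
            (cong from (child-unique (subst (λ w → Adj w (to x)) (strictlyInverseˡ _) v~x) d<ρ (≰⇒> deep)))
            (strictlyInverseʳ x)

  -- All legs fill up in parallel, one layer per round: once the layers up to a vertex are
  -- monitored, only its child can be missing, so it propagates.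
  centres-monitor : ∀ i v → depth v ≤ suc i → from v ∈ P centres (suc i)
  centres-monitor zero (centre j) _ =
    ∈N[]ₛ⁺ H {centres} {from (centre j)} (from-centre∈centres j) (∈N[]⁺ H _ (from (centre j)) (inj₁ refl))
  centres-monitor zero (leg j zero k) _ =
    ∈N[]ₛ⁺ H {centres} {from (leg j zero k)} {from (centre j)} (from-centre∈centres j)
      (∈N[]⁺ H (from (leg j zero k)) (from (centre j)) (inj₂ (adj⇒~ (inj₁ spoke))))
  centres-monitor zero (leg j (suc d) k) (s≤s ())
  centres-monitor (suc i) v dp = extend v (m≤n⇒m<n∨m≡n dp)
    where
    extend : ∀ v → depth v < suc (suc i) ⊎ depth v ≡ suc (suc i) → from v ∈ P centres (suc (suc i))
    extend v (inj₁ dp<) = P⊆P-suc H centres i (centres-monitor i v (s≤s⁻¹ dp<))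
    extend (leg j (suc d) k) (inj₂ dp≡) = N⊆P-suc H centres i w
        (centres-monitor i (leg j (inject₁ d) k) (≤-reflexive (cong suc d≡i)))
        -- The parent is not the end of its leg: `suc d` lies in `Fin r`, so `d` lies in `Fin ρ`.
        (unmonitored-child (centres-monitor i) d≡i (subst (_< ρ) (sym (toℕ-inject₁ d)) (toℕ<n d)))
        (∈N[]⁺ H (from (leg j (suc d) k)) w (inj₂ (adj⇒~ (inj₁ (along (cong suc (sym (toℕ-inject₁ d))))))))
      where
      w : Vertex
      w = from (leg j (inject₁ d) k)

      d≡i : toℕ (inject₁ d) ≡ i
      d≡i = trans (toℕ-inject₁ d) (ℕ.suc-injective (ℕ.suc-injective dp≡))

  P-centres-r : P centres r ≡ ⊤
  P-centres-r = ⊆-antisym ⊆⊤ λ {u} _ →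
    subst (_∈ P centres r) (strictlyInverseʳ u) (centres-monitor ρ (to u) (depth≤r (to u)))

  centres-PDS : IsPDS centres
  centres-PDS = r , s≤s z≤n , P-centres-r

  spider : V → Fin g
  spider = proj₁

  ∣centres∣≤g : ∣ centres ∣ ≤ g
  ∣centres∣≤g = covered⇒∣p∣≤ centres (λ i → from (centre i)) λ {x} x∈ →
    spider (to x) ,
    trans (cong from (is-centre (to x) (∈-subset⁻ centre? x∈))) (strictlyInverseʳ x)
    where
    is-centre : ∀ v → depth v ≡ 0 → centre (spider v) ≡ v
    is-centre (centre i) _ = refl

  -- Lower bounds

  OnLeg : Fin g → Fin Δ → V → Set
  OnLeg i k (centre j)  = ⊥
  OnLeg i k (leg j d l) = j ≡ i × l ≡ k

  onLeg? : ∀ i k v → Dec (OnLeg i k v)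
  onLeg? i k (centre j)  = no λ ()
  onLeg? i k (leg j d l) = (j Fin.≟ i) ×-dec (l Fin.≟ k)

  onLeg⇒spider : ∀ {i k} v → OnLeg i k v → spider v ≡ i
  onLeg⇒spider (leg i d k) (eq , _) = eq

  -- Links touch only leg 0, so a leg of index `suc k` can be reached from outside only through its
  -- centre.
  enter-leg : ∀ {i k v w} → Adj v w → OnLeg i (suc k) w → OnLeg i (suc k) v ⊎ v ≡ centre i
  enter-leg (inj₁ spoke) (refl , _) = inj₂ refl
  enter-leg (inj₁ (along _)) on = inj₁ on
  enter-leg (inj₂ (along _)) on = inj₁ on

  -- Links do no harm, as both of their ends have depth `r`.
  depth-lipschitz : ∀ {v w} → Adj v w → depth w ≤ suc (depth v)
  depth-lipschitz (inj₁ spoke) = ≤-refl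
  depth-lipschitz (inj₂ spoke) = z≤n
  depth-lipschitz (inj₁ (along eq)) = s≤s (≤-reflexive eq)
  depth-lipschitz (inj₂ (along eq)) = s≤s (≤-trans (n≤1+n _) (≤-trans (≤-reflexive (sym eq)) (n≤1+n _)))
  depth-lipschitz (inj₁ (link p q _)) = s≤s (m≤n⇒m≤1+n (≤-reflexive (trans q (sym p))))
  depth-lipschitz (inj₂ (link p q _)) = s≤s (m≤n⇒m≤1+n (≤-reflexive (trans p (sym q))))

  -- The invariant is the same in every round and covers all nonzero legs of spider `j` at once. It
  -- leaves room for the centre and leg 0 to become monitored from neighbouring spiders.
  unhit⇒unmonitored : ∀ {S j} → (∀ {v} → v ∈ S → spider (to v) ≢ j) →
    ∀ i {u k} → u ∈ P S (suc i) → ¬ OnLeg j (suc k) (to u)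
  unhit⇒unmonitored {S} {j} unhit i {k = k} u∈ = P-invariant H S Q base (λ q → q) (λ {i} → step {i}) i u∈ k
    where
    Q : ℕ → Pred Vertex 0ℓ
    Q _ u = ∀ k → ¬ OnLeg j (suc k) (to u)

    base : ∀ {u v} → v ∈ S → u ∈ N[ v ] → Q 0 u
    base {u} {v} v∈S u∈ k on with ∈N[]⁻ H u∈
    ... | inj₁ refl = unhit v∈S (onLeg⇒spider (to u) on)
    ... | inj₂ v~u with enter-leg v~u on
    ...   | inj₁ on′ = unhit v∈S (onLeg⇒spider (to v) on′)
    ...   | inj₂ eq  = unhit v∈S (cong spider eq)

    step : ∀ {i X u v} → (∀ {x} → x ∈ X → Q i x) → v ∈ X → ∣ N[ v ] ─ X ∣ ≤ 1 → u ∈ N[ v ] → Q (suc i) u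
    step {X = X} {u} {v} Q-X v∈X small u∈ k on with ∈N[]⁻ H u∈
    ... | inj₁ refl = Q-X v∈X k on
    ... | inj₂ v~u with enter-leg v~u on
    ...   | inj₁ on′ = Q-X v∈X k on′
    ...   | inj₂ eq  = contradiction (≤-trans (injective⇒≤∣p∣ (N[ v ] ─ X) first first-injective first∈) small) 1+n≰n
      where
      first : Fin 2 → Vertex
      -- The first vertices of legs 1 and 2: two unmonitored neighbours, which stop the centre from
      -- propagating.
      first s = from (leg j zero (suc (Fin.inject≤ s (s≤s (s≤s z≤n)))))

      first-injective : ∀ {s t} → first s ≡ first t → s ≡ t
      first-injective {0F} {0F} _ = refl
      first-injective {1F} {1F} _ = refl
      first-injective {0F} {1F} e = contradiction (from-injective e) λ ()
      first-injective {1F} {0F} e = contradiction (from-injective e) λ ()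

      first∈ : ∀ s → first s ∈ N[ v ] ─ X
      first∈ s = x∈p∧x∉q⇒x∈p─q
        (∈N[]⁺ H (first s) v (inj₂ (subst₂ Adj (sym eq) (sym (strictlyInverseˡ _)) (inj₁ spoke))))
        (λ ∈X → Q-X ∈X _ (subst (OnLeg j _) (sym (strictlyInverseˡ _)) (refl , refl)))

  PDS-hits : ∀ {S} → IsPDS S → ∀ j → ∃[ u ] (u ∈ S × spider (to u) ≡ j)
  PDS-hits {S} (suc i , _ , full) j with any? (λ u → (u ∈? S) ×-dec (spider (to u) Fin.≟ j))
  ... | yes hit  = hit
  ... | no ¬hit = contradiction (subst (OnLeg j 1F) (sym (strictlyInverseˡ _)) (refl , refl))
          (unhit⇒unmonitored (λ v∈S eq → ¬hit (_ , v∈S , eq)) i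
            {from (leg j zero 1F)} {0F} (subst (_ ∈_) (sym full) ∈⊤))

  -- Choosing one vertex of a power dominating set in each spider.

  module _ {S} (pds : IsPDS S) where

    hit : Fin g → Vertex
    hit j = proj₁ (PDS-hits pds j)

    hit∈S : ∀ j → hit j ∈ S
    hit∈S j = proj₁ (proj₂ (PDS-hits pds j))

    spider-hit : ∀ j → spider (to (hit j)) ≡ j
    spider-hit j = proj₂ (proj₂ (PDS-hits pds j))

    hit-injective : ∀ {i j} → hit i ≡ hit j → i ≡ j
    hit-injective {i} {j} eq = trans (sym (spider-hit i)) (trans (cong (spider ∘ to) eq) (spider-hit j))

    g≤∣PDS∣ : g ≤ ∣ S ∣
    g≤∣PDS∣ = injective⇒≤∣p∣ S hit hit-injective hit∈S

    -- Otherwise `u` together with the `g` chosen vertices would give `suc g` distinct elements of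
    -- `S`.
    hit-unique : ∣ S ∣ ≤ g → ∀ {u} → u ∈ S → u ≡ hit (spider (to u))
    hit-unique ∣S∣≤g {u} u∈S with u Fin.≟ hit (spider (to u))
    ... | yes eq = eq
    ... | no neq = contradiction (≤-trans (injective⇒≤∣p∣ S f f-injective f∈S) ∣S∣≤g) 1+n≰n
      where
      f : Fin (suc g) → Vertex
      f zero    = u
      f (suc j) = hit j

      u≢hit : ∀ j → u ≢ hit j
      u≢hit j refl = neq (cong hit (sym (spider-hit j)))

      f-injective : ∀ {i j} → f i ≡ f j → i ≡ j
      f-injective {zero}  {zero}  eq = refl
      f-injective {zero}  {suc j} eq = contradiction eq (u≢hit j)
      f-injective {suc i} {zero}  eq = contradiction (sym eq) (u≢hit i)
      f-injective {suc i} {suc j} eq = cong suc (hit-injective eq)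

      f∈S : ∀ i → f i ∈ S
      f∈S zero    = u∈S
      f∈S (suc j) = hit∈S j

    -- Spider 0 contains a single vertex of `S`, which cannot lie on both leg 1 and leg 2. The
    -- witness `k` stands for leg `suc k`.
    free-leg : ∣ S ∣ ≤ g → ∃[ k ] (∀ {u} → u ∈ S → ¬ OnLeg zero (suc k) (to u))
    free-leg ∣S∣≤g with onLeg? zero 1F (to (hit zero))
    ... | no ¬on = 0F , λ {u} u∈S on → ¬on (subst (OnLeg zero 1F ∘ to) (is-hit u∈S on) on)
      where
      is-hit : ∀ {u k} → u ∈ S → OnLeg zero k (to u) → u ≡ hit zero
      is-hit {u} u∈S on = trans (hit-unique ∣S∣≤g u∈S) (cong hit (onLeg⇒spider (to u) on))
    ... | yes on = 1F , λ {u} u∈S on′ → legs-disjoint (to (hit zero)) on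
            (subst (OnLeg zero 2F ∘ to) (trans (hit-unique ∣S∣≤g u∈S) (cong hit (onLeg⇒spider (to u) on′))) on′)
      where
      legs-disjoint : ∀ v → OnLeg zero 1F v → ¬ OnLeg zero 2F v
      legs-disjoint (leg _ _ _) (_ , refl) (_ , ())

  -- Monitoring must enter this leg from its centre, at depth 0, and each round advances along
  -- edges, which raise the depth by at most one.
  leg-speed : ∀ {S j k} → (∀ {u} → u ∈ S → ¬ OnLeg j (suc k) (to u)) →
    ∀ i {u} → u ∈ P S (suc i) → OnLeg j (suc k) (to u) → depth (to u) ≤ suc i
  leg-speed {S} {j} {k} free = P-invariant H S Q base (λ q on → m≤n⇒m≤1+n (q on)) step
    where
    Q : ℕ → Pred Vertex 0ℓ
    Q i u = OnLeg j (suc k) (to u) → depth (to u) ≤ suc i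

    base : ∀ {u v} → v ∈ S → u ∈ N[ v ] → Q 0 u
    base {u} {v} v∈S u∈ on with ∈N[]⁻ H u∈
    ... | inj₁ refl = contradiction on (free v∈S)
    ... | inj₂ v~u with enter-leg v~u on
    ...   | inj₁ on′ = contradiction on′ (free v∈S)
    ...   | inj₂ eq  = subst (λ v → depth (to u) ≤ suc (depth v)) eq (depth-lipschitz v~u)

    step : ∀ {i X u v} → (∀ {x} → x ∈ X → Q i x) → v ∈ X → ∣ N[ v ] ─ X ∣ ≤ 1 → u ∈ N[ v ] → Q (suc i) u
    step {u = u} {v} Q-X v∈X _ u∈ on with ∈N[]⁻ H u∈
    ... | inj₁ refl = m≤n⇒m≤1+n (Q-X v∈X on)
    ... | inj₂ v~u with enter-leg v~u on
    ...   | inj₁ on′ = ≤-trans (depth-lipschitz v~u) (s≤s (Q-X v∈X on′))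
    ...   | inj₂ eq  = ≤-trans (subst (λ v → depth (to u) ≤ suc (depth v)) eq (depth-lipschitz v~u)) (s≤s z≤n)

  r≤radius : ∀ {S} → ∣ S ∣ ≤ g → ∀ i → 1 ≤ i × P S i ≡ ⊤ → r ≤ i
  -- The end of the free leg has depth `r` and is monitored by round `suc i`, so the speed bound
  -- applies to it.
  r≤radius {S} ∣S∣≤g (suc i) (1≤i , full) with free-leg (suc i , 1≤i , full) ∣S∣≤g
  ... | k , free = subst (_≤ suc i) depth-end
          (leg-speed free i (subst (end ∈_) (sym full) ∈⊤)
            (subst (OnLeg zero (suc k)) (sym (strictlyInverseˡ _)) (refl , refl)))
    where
    end : Vertex
    end = from (leg zero tip (suc k))

    depth-end : depth (to end) ≡ r
    depth-end = trans (cong depth (strictlyInverseˡ _)) (cong suc (toℕ-fromℕ ρ))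

  -- The exact values of the two invariants.

  ∣centres∣≡g : ∣ centres ∣ ≡ g
  ∣centres∣≡g = ≤-antisym ∣centres∣≤g (g≤∣PDS∣ centres-PDS)

  powerDominationNumber : IsPowerDominationNumber g
  powerDominationNumber = (centres , centres-PDS , ∣centres∣≡g) , λ { _ (S , pds , refl) → g≤∣PDS∣ pds }

  propagationRadius : IsPropagationRadius r
  propagationRadius =
    (centres , centres-PDS , subst IsPowerDominationNumber (sym ∣centres∣≡g) powerDominationNumber ,
      (s≤s z≤n , P-centres-r) , r≤radius ∣centres∣≤g) ,
    -- Minimality of the size of `S`, compared with `centres`, gives the bound by `g` that
    -- `r≤radius` asks for.
    λ { i (S , _ , (_ , minimal) , full , _) →
          r≤radius (minimal g (centres , centres-PDS , ∣centres∣≡g)) i full }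

mainTheorem7 : (Δ r g : ℕ) → Δ ≥ 3 → r ≥ 1 → g ≥ 1 →
    Σ Graph (λ H →
    Graph.Connected H ×
    Graph.IsMaximumDegree H Δ ×
    Graph.IsPowerDominationNumber H g ×
    Graph.IsPropagationRadius H r ×
    Graph.order H ≡ g * (r * Δ + 1))
mainTheorem7 (suc (suc (suc δ))) (suc ρ) (suc γ) (s≤s (s≤s (s≤s z≤n))) _ _ =
  H , connected , maximumDegree , powerDominationNumber , propagationRadius , refl
  where open Spiders ρ δ γ
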